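{- $\mathrm{bitpdim}(\mathrm{SI}_d)=\Omega\left(\frac{d^3}{\log d}\right)$ (as $d\to\infty$); that is, $\mathrm{bitpdim}(\mathrm{SI}_d)$ is at least $\Omega\left(\frac{d^{3}}{\log d}\right)$.
   Context: $\mathrm{SI}_d:\mathbb{F}_2^{d\times d}\times\mathbb{F}_2^{d\times d}\to\{0,1\}$ is defined by $\mathrm{SI}_d(A,B)=1$ iff $\mathrm{rowspan}(A)\cap\mathrm{rowspan}(B)\ne\{0\}$ (row spans over $\mathbb{F}_2$). It is viewed as a function $\{0,1\}^n\times\{0,1\}^n\to\{0,1\}$ with $n=d^2$, the left part of the input being $A$ and the right part $B$. Bitwise decomposable projective dimension: for $f:\{0,1\}^n\times\{0,1\}^n\to\{0,1\}$, $\mathrm{bitpdim}(f)\le D$ if there are subspaces of $\mathbb{F}_2^D$, $\mathcal{C}=\{U_i^a\}_{i\in[n],a\in\{0,1\}}$ and $\mathcal{D}=\{V_j^b\}_{j\in[n],b\in\{0,1\}}$, such that: (1) with $\phi(x)=\mathrm{span}_{1\le i\le n}U_i^{x_i}$ for $x\in\{0,1\}^n$ on the left side and $\phi(y)=\mathrm{span}_{1\le j\le n}V_j^{y_j}$ for $y\in\{0,1\}^n$ on the right side, for all $(x,y)$: $f(x,y)=1$ iff $\phi(x)\cap\phi(y)\neq\{0\}$; (2) each $W\in\mathcal{C}\cup\mathcal{D}$ equals $\mathrm{span}(S')$ for some $S'\subseteq S=\{e_i-e_j: i,j\in[D], i\ne j\}$, where $e_i$ are the standard basis vectors; (3) for all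 disjoint $S_1,S_2\subseteq[n]\times\{0,1\}$, $\mathrm{span}_{(i,a)\in S_1}U_i^a\cap\mathrm{span}_{(j,b)\in S_2}U_j^b=\{0\}$, and likewise for the subspaces $V_j^b$ in $\mathcal{D}$. $\mathrm{bitpdim}(f)$ is the least such $D$. -}

module Defs where

open import Data.Bool.Base using (Bool; true; false; _∧_; _xor_)
import Data.Bool.Properties as Bool
open import Data.Fin.Base using (Fin; combine)
open import Data.Fin.Subset.Properties using (anySubset?)
open import Data.Nat.Base using (ℕ; _*_)
open import Data.Product.Base using (∃-syntax; Σ-syntax; _×_; _,_)
open import Data.Vec.Base using (Vec; []; _∷_; lookup; map; replicate; tabulate; zipWith; _[_]≔_)
open import Data.Vec.Properties using (≡-dec)
open import Function.Bundles using (_⇔_)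
open import Level using (0ℓ)
open import Relation.Binary.Definitions using (DecidableEquality)
open import Relation.Binary.PropositionalEquality using (_≡_; _≢_; refl)
open import Relation.Nullary.Decidable using (Dec; yes; no; does; ¬?; _×-dec_; decidable-stable)
open import Relation.Nullary.Negation using (¬_)
open import Relation.Unary using (Pred; Decidable; _∈_; _⊆_; _∩_; _≐_; _⊥_; ｛_｝)

-- 𝔽₂ is Bool with _xor_ as + and _∧_ as ·.

𝔽₂^ : ℕ → Set
𝔽₂^ D = Vec Bool D

infixl 6 _⊕_
infixr 7 _·_

𝟎 : ∀ {D} → 𝔽₂^ D
𝟎 = replicate _ false

_⊕_ : ∀ {D} → 𝔽₂^ D → 𝔽₂^ D → 𝔽₂^ D
_⊕_ = zipWith _xor_

_·_ : ∀ {D} → Bool → 𝔽₂^ D → 𝔽₂^ D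
c · v = map (c ∧_) v

e : ∀ {D} → Fin D → 𝔽₂^ D
e i = 𝟎 [ i ]≔ true

_≟ᵥ_ : ∀ {D} → DecidableEquality (𝔽₂^ D)
_≟ᵥ_ = ≡-dec Bool._≟_

-- Closure under scalars is automatic: the only scalars are 0 and 1.
record Subspace (D : ℕ) : Set₁ where
  field
    ⟦_⟧      : Pred (𝔽₂^ D) 0ℓ
    𝟎-closed : 𝟎 ∈ ⟦_⟧
    ⊕-closed : ∀ {u v} → u ∈ ⟦_⟧ → v ∈ ⟦_⟧ → u ⊕ v ∈ ⟦_⟧

open Subspace public using (⟦_⟧)

data Span {D : ℕ} (S : Pred (𝔽₂^ D) 0ℓ) : Pred (𝔽₂^ D) 0ℓ where
  gen  : ∀ {v} → v ∈ S → v ∈ Span S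
  zero : 𝟎 ∈ Span S
  add  : ∀ {u v} → u ∈ Span S → v ∈ Span S → u ⊕ v ∈ Span S

IsZero : ∀ {D} → Pred (𝔽₂^ D) 0ℓ → Set
IsZero P = P ≐ ｛ 𝟎 ｝

isZero? : ∀ {D} {P : Pred (𝔽₂^ D) 0ℓ} → Decidable P → Dec (IsZero P)
isZero? P? with P? 𝟎 | anySubset? (λ v → P? v ×-dec ¬? (𝟎 ≟ᵥ v))
... | no 𝟎∉P | _                   = no λ (_ , ⊇) → 𝟎∉P (⊇ refl)
... | yes _   | yes (_ , v∈P , v≢𝟎) = no λ (⊆ , _) → v≢𝟎 (⊆ v∈P)
... | yes 𝟎∈P | no ∄ = yes
  ( (λ {v} v∈P → decidable-stable (𝟎 ≟ᵥ v) λ v≢𝟎 → ∄ (v , v∈P , v≢𝟎))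
  , λ { refl → 𝟎∈P } )

Matrix : ℕ → ℕ → Set
Matrix m D = Vec (𝔽₂^ D) m

combination : ∀ {m D} → Vec Bool m → Matrix m D → 𝔽₂^ D
combination []       []       = 𝟎
combination (c ∷ cs) (r ∷ rs) = c · r ⊕ combination cs rs

rowspan : ∀ {m D} → Matrix m D → Pred (𝔽₂^ D) 0ℓ
rowspan A v = ∃[ c ] combination c A ≡ v

rowspan? : ∀ {m D} (A : Matrix m D) → Decidable (rowspan A)
rowspan? A v = anySubset? λ c → combination c A ≟ᵥ v

-- Row-major: the entry in row i and column j is bit number i * d + j.
toMatrix : (d : ℕ) → Vec Bool (d * d) → Matrix d d
toMatrix d x = tabulate λ i → tabulate λ j → lookup x (combine i j)

SI : (d : ℕ) → Vec Bool (d * d) → Vec Bool (d * d) → Bool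
SI d x y = does (¬? (isZero? λ v → rowspan? A v ×-dec rowspan? B v))
  where
  A = toMatrix d x
  B = toMatrix d y

-- U i a stands for U_i^a, with a = false for 0 and a = true for 1.
Family : ℕ → ℕ → Set₁
Family n D = Fin n → Bool → Subspace D

spanOver : ∀ {n D} → Family n D → Pred (Fin n × Bool) 0ℓ → Pred (𝔽₂^ D) 0ℓ
spanOver U S = Span λ v → ∃[ i ] ∃[ a ] (i , a) ∈ S × v ∈ ⟦ U i a ⟧

φ : ∀ {n D} → Family n D → Vec Bool n → Pred (𝔽₂^ D) 0ℓ
φ U x = spanOver U λ (i , a) → a ≡ lookup x i

-- The vectors e i - e j with i ≢ j; in characteristic 2, subtraction is _⊕_.
Differences : ∀ {D} → Pred (𝔽₂^ D) 0ℓ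
Differences v = ∃[ i ] ∃[ j ] i ≢ j × v ≡ e i ⊕ e j

SpannedByDifferences : ∀ {D} → Subspace D → Set₁
SpannedByDifferences {D} W =
  Σ[ S′ ∈ Pred (𝔽₂^ D) 0ℓ ] S′ ⊆ Differences × ⟦ W ⟧ ≐ Span S′

Independent : ∀ {n D} → Family n D → Set₁
Independent U = ∀ S₁ S₂ → S₁ ⊥ S₂ → IsZero (spanOver U S₁ ∩ spanOver U S₂)

record BitwiseDecomposition {n : ℕ} (f : Vec Bool n → Vec Bool n → Bool) (D : ℕ) : Set₁ where
  field
    U V           : Family n D
    represents    : ∀ x y → f x y ≡ true ⇔ (¬ IsZero (φ U x ∩ φ V y))
    U-differences : ∀ i a → SpannedByDifferences (U i a)
    V-differences : ∀ j b → SpannedByDifferences (V j b)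
    U-independent : Independent U
    V-independent : Independent V

-- bitpdim f is the least D with bitpdim f ≤ D, so a lower bound on bitpdim f
-- is a lower bound on every such D.
bitpdim_≤_ : ∀ {n} → (Vec Bool n → Vec Bool n → Bool) → ℕ → Set₁
bitpdim f ≤ D = BitwiseDecomposition f D

-- Nečiporuk's method. Fix all of B and all rows of A but row t. The span W of the U-pieces of row t
-- meets the span R of the other pieces of A (set to 0) trivially, so SI depends on the free row only
-- through W ∩ (R + φ B). Both W and R + φ B are spanned by edge vectors e i - e j, and so this
-- intersection is determined by how the at most 2m endpoints of an edge basis of W, m = dim W, are
-- distributed over the components of the graph of R + φ B: there are at most (1 + 2m)^(2m)
-- possibilities. On the other hand, letting B be [ I | M ] with M any h × k matrix, h = ⌊d/2⌋ and
-- k = ⌈d/2⌉, gives 2^(h k) distinct functions of row t, so m = Ω(d² / log d). By independence the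
-- dimensions of the d rows add up to at most D. Subspaces need not be decidable; since the conclusion
-- is, the finitely many instances of excluded middle are available under a double negation.

module Submission where

open import Defs
open import Data.Nat using (ℕ; _*_; _^_; _≤_; _≥_)
open import Data.Nat.Logarithm using (⌊log₂_⌋)
open import Data.Product using (∃-syntax)

open import Algebra.Bundles using (CommutativeSemigroup)
import Algebra.Properties.CommutativeSemigroup as CommutativeSemigroupProperties
open import Data.Bool.Base using (Bool; true; false; _∧_; _xor_)
open import Data.Bool.Properties
  using (xor-assoc; xor-comm; xor-identityˡ; xor-identityʳ; xor-same; ∧-zeroʳ)
open import Data.Fin.Base
  using ( Fin; zero; suc; inject₁; combine; quotient; remainder; funToFin; finToFun; splitAt
        ; _↑ˡ_; _↑ʳ_)
open import Data.Fin.Properties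
  using ( 2↔Bool; any?; combine-remQuot; combine-surjective; finToFun-funToFin; funToFin-finToFin
        ; inject₁-injective; injective⇒≤; sequence; splitAt-↑ˡ)
  renaming (_≟_ to _≟ᶠ_)
open import Data.List.Base using (List; []; _∷_; allFin; cartesianProduct)
open import Data.List.Membership.Propositional renaming (_∈_ to _∈ₗ_)
open import Data.List.Membership.Propositional.Properties using (∈-allFin; ∈-cartesianProduct⁺)
open import Data.List.Relation.Unary.Any using (here; there)
open import Data.Nat using (zero; suc; _+_; _<_; s≤s; z≤n; ⌊_/2⌋; ⌈_/2⌉)
open import Data.Nat.Logarithm using (⌊log₂⌋-mono-≤; ⌊log₂[2^n]⌋≡n)
import Data.Nat.Properties as ℕ
open import Data.Nat.Solver using (module +-*-Solver)
open import Data.Product using (Σ-syntax; _×_; _,_; proj₁; proj₂)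
open import Data.Sum.Base using (inj₁; inj₂; [_,_]′)
open import Data.Vec.Base
  using (Vec; []; _∷_; lookup; map; replicate; tabulate; concat; sum; _++_; _[_]≔_)
import Data.Vec.Base as Vec
open import Data.Vec.Properties
open import Effect.Monad using (module RawMonad)
open import Function.Base using (_∘_)
open import Function.Bundles using (Equivalence; Injection; Inverse; _⇔_; mk⇔)
open import Function.Properties.Inverse using (↔⇒↣)
open import Level using (0ℓ)
open import Relation.Binary.PropositionalEquality
open import Relation.Nullary.Decidable
  using (Dec; yes; no; does; ¬?; _×-dec_; decidable-stable; ¬¬-excluded-middle)
open import Relation.Nullary.Negation using (¬_; contradiction; ¬¬-map; ¬¬-Monad)
open import Relation.Unary using (Pred; Decidable; _∈_; _⊆_; _∩_)

private variable
  D E m n : ℕ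

-- Arithmetic: from the counting inequality to the bound on `d ^ 3`.

n<2^1+⌊log₂n⌋ : ∀ n → n < 2 ^ suc ⌊log₂ n ⌋
n<2^1+⌊log₂n⌋ n = ℕ.≰⇒> λ 2^≤n →
  ℕ.1+n≰n (ℕ.≤-trans (ℕ.≤-reflexive (sym (⌊log₂[2^n]⌋≡n (suc ⌊log₂ n ⌋)))) (⌊log₂⌋-mono-≤ 2^≤n))

-- Four times the product is `d * d` or one less, so a factor 5 absorbs the parity once `d` is at
-- least 2. The induction goes in steps of two, which raise both halves by one.
square≤5⌊⌋⌈⌉ : ∀ d → 2 ≤ d → d * d ≤ 5 * (⌊ d /2⌋ * ⌈ d /2⌉)
square≤5⌊⌋⌈⌉ 0 ()
square≤5⌊⌋⌈⌉ 1 (s≤s ())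
square≤5⌊⌋⌈⌉ 2 _ = s≤s (s≤s (s≤s (s≤s z≤n)))
square≤5⌊⌋⌈⌉ 3 _ = ℕ.m≤m+n 9 1
square≤5⌊⌋⌈⌉ (suc (suc d@(suc (suc _)))) _ = begin
  (2 + d) * (2 + d)
    ≡⟨ solve 1 (λ d → (con 2 :+ d) :* (con 2 :+ d) := d :* d :+ con 4 :* d :+ con 4) refl d ⟩
  d * d + 4 * d + 4
    ≤⟨ ℕ.+-monoˡ-≤ 4 (ℕ.+-mono-≤ (square≤5⌊⌋⌈⌉ d (s≤s (s≤s z≤n))) (ℕ.*-monoˡ-≤ d (ℕ.m≤m+n 4 1))) ⟩
  5 * (h * k) + 5 * d + 4
    ≤⟨ ℕ.+-monoʳ-≤ (5 * (h * k) + 5 * d) (ℕ.m≤m+n 4 1) ⟩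
  5 * (h * k) + 5 * d + 5
    ≡⟨ cong (λ z → 5 * (h * k) + 5 * z + 5) (ℕ.⌊n/2⌋+⌈n/2⌉≡n d) ⟨
  5 * (h * k) + 5 * (h + k) + 5
    ≡⟨ solve 2 (λ h k → con 5 :* (h :* k) :+ con 5 :* (h :+ k) :+ con 5
                     := con 5 :* ((con 1 :+ h) :* (con 1 :+ k))) refl h k ⟩
  5 * (suc h * suc k) ∎
  where
  open ℕ.≤-Reasoning
  open +-*-Solver
  h = ⌊ d /2⌋
  k = ⌈ d /2⌉

-- With `L = ⌊log₂ d ⌋`, the threshold `2 ^ suc L * 2 ^ suc L` exceeds `d * d`. If `m + m` reaches
-- it, `m` is large enough on its own; otherwise the base `suc (m + m)` is at most this power of 2
-- and the exponents can be compared.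
size-bound : ∀ d m → 2 ≤ d → 2 ^ (⌊ d /2⌋ * ⌈ d /2⌉) ≤ suc (m + m) ^ (m + m) →
  d * d ≤ 40 * ⌊log₂ d ⌋ * m
size-bound d m 2≤d bound with ℕ.<-≤-connex (m + m) (2 ^ suc ⌊log₂ d ⌋ * 2 ^ suc ⌊log₂ d ⌋)
... | inj₂ large = begin
  d * d                ≤⟨ ℕ.*-mono-≤ d≤ d≤ ⟩
  2 ^ suc L * 2 ^ suc L ≤⟨ large ⟩
  m + m                ≡⟨ solve 1 (λ m → m :+ m := con 2 :* con 1 :* m) refl m ⟩
  2 * 1 * m            ≤⟨ ℕ.*-monoˡ-≤ m (ℕ.*-mono-≤ (ℕ.m≤m+n 2 38) 1≤L) ⟩
  40 * L * m           ∎
  where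
  open ℕ.≤-Reasoning
  open +-*-Solver
  L = ⌊log₂ d ⌋
  d≤ : d ≤ 2 ^ suc L
  d≤ = ℕ.<⇒≤ (n<2^1+⌊log₂n⌋ d)
  1≤L : 1 ≤ L
  1≤L = ⌊log₂⌋-mono-≤ 2≤d
... | inj₁ small = begin
  d * d
    ≤⟨ square≤5⌊⌋⌈⌉ d 2≤d ⟩
  5 * (⌊ d /2⌋ * ⌈ d /2⌉)
    ≤⟨ ℕ.*-monoʳ-≤ 5 exponent≤ ⟩
  5 * ((suc L + suc L) * (m + m))
    ≤⟨ ℕ.*-monoʳ-≤ 5 (ℕ.*-monoˡ-≤ (m + m) (ℕ.+-mono-≤ 1+L≤2L 1+L≤2L)) ⟩
  5 * (((L + L) + (L + L)) * (m + m))
    -- The constant is 5 · 4 · 2: the parity factor, four copies of `L` from doubling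
    -- `suc L ≤ L + L`, and two copies of `m`.
    ≡⟨ solve 2 (λ L m → con 5 :* (((L :+ L) :+ (L :+ L)) :* (m :+ m)) := con 40 :* L :* m) refl L m ⟩
  40 * L * m ∎
  where
  open ℕ.≤-Reasoning
  open +-*-Solver
  L = ⌊log₂ d ⌋
  1+L≤2L : suc L ≤ L + L
  1+L≤2L = ℕ.+-monoˡ-≤ L (⌊log₂⌋-mono-≤ 2≤d)
  2^≤ : 2 ^ (⌊ d /2⌋ * ⌈ d /2⌉) ≤ 2 ^ ((suc L + suc L) * (m + m))
  2^≤ = begin
    2 ^ (⌊ d /2⌋ * ⌈ d /2⌉)        ≤⟨ bound ⟩
    suc (m + m) ^ (m + m)          ≤⟨ ℕ.^-monoˡ-≤ (m + m) small ⟩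
    (2 ^ suc L * 2 ^ suc L) ^ (m + m)  ≡⟨ cong (_^ (m + m)) (ℕ.^-distribˡ-+-* 2 (suc L) (suc L)) ⟨
    (2 ^ (suc L + suc L)) ^ (m + m)  ≡⟨ ℕ.^-*-assoc 2 (suc L + suc L) (m + m) ⟩
    2 ^ ((suc L + suc L) * (m + m)) ∎
  exponent≤ : ⌊ d /2⌋ * ⌈ d /2⌉ ≤ (suc L + suc L) * (m + m)
  exponent≤ = ℕ.≮⇒≥ λ lt → ℕ.<⇒≱ (ℕ.^-monoʳ-< 2 (s≤s (s≤s z≤n)) lt) 2^≤

*≤*sum : ∀ {n} a c (f : Fin n → ℕ) → (∀ t → a ≤ c * f t) → n * a ≤ c * sum (tabulate f)
*≤*sum {zero}  a c f a≤ = z≤n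
*≤*sum {suc n} a c f a≤ = ℕ.≤-trans (ℕ.+-mono-≤ (a≤ zero) (*≤*sum a c (f ∘ suc) (a≤ ∘ suc)))
  (ℕ.≤-reflexive (sym (ℕ.*-distribˡ-+ c (f zero) _)))

cube-bound : ∀ {d D} L (f : Fin d → ℕ) → (∀ t → d * d ≤ 40 * L * f t) → sum (tabulate f) ≤ D →
  d ^ 3 ≤ 40 * (D * L)
cube-bound {d} {D} L f d²≤ sum≤D = begin
  d ^ 3                        ≡⟨ cong (λ z → d * (d * z)) (ℕ.*-identityʳ d) ⟩
  d * (d * d)                  ≤⟨ *≤*sum (d * d) (40 * L) f d²≤ ⟩
  40 * L * sum (tabulate f)    ≤⟨ ℕ.*-monoʳ-≤ (40 * L) sum≤D ⟩
  40 * L * D                   ≡⟨ ℕ.*-assoc 40 L D ⟩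
  40 * (L * D)                 ≡⟨ cong (40 *_) (ℕ.*-comm L D) ⟩
  40 * (D * L)                 ∎
  where open ℕ.≤-Reasoning

open ≡-Reasoning

-- Vector algebra over 𝔽₂ and row combinations.

⊕-assoc : (u v w : 𝔽₂^ D) → (u ⊕ v) ⊕ w ≡ u ⊕ (v ⊕ w)
⊕-assoc = zipWith-assoc xor-assoc

⊕-comm : (u v : 𝔽₂^ D) → u ⊕ v ≡ v ⊕ u
⊕-comm = zipWith-comm xor-comm

⊕-identityˡ : (u : 𝔽₂^ D) → 𝟎 ⊕ u ≡ u
⊕-identityˡ = zipWith-identityˡ xor-identityˡ

⊕-identityʳ : (u : 𝔽₂^ D) → u ⊕ 𝟎 ≡ u
⊕-identityʳ = zipWith-identityʳ xor-identityʳ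

⊕-self : (u : 𝔽₂^ D) → u ⊕ u ≡ 𝟎
⊕-self []      = refl
⊕-self (x ∷ u) = cong₂ _∷_ (xor-same x) (⊕-self u)

⊕-commutativeSemigroup : ℕ → CommutativeSemigroup 0ℓ 0ℓ
⊕-commutativeSemigroup D = record
  { Carrier = 𝔽₂^ D
  ; _≈_ = _≡_
  ; _∙_ = _⊕_
  ; isCommutativeSemigroup = record
    { isSemigroup = record
      { isMagma = record { isEquivalence = isEquivalence ; ∙-cong = cong₂ _⊕_ }
      ; assoc = ⊕-assoc
      }
    ; comm = ⊕-comm
    }
  }

⊕-interchange : (a b c d : 𝔽₂^ D) → (a ⊕ b) ⊕ (c ⊕ d) ≡ (a ⊕ c) ⊕ (b ⊕ d)
⊕-interchange {D} = CommutativeSemigroupProperties.interchange (⊕-commutativeSemigroup D)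

⊕-cancelʳ : (u v : 𝔽₂^ D) → (u ⊕ v) ⊕ v ≡ u
⊕-cancelʳ u v = begin
  (u ⊕ v) ⊕ v  ≡⟨ ⊕-assoc u v v ⟩
  u ⊕ (v ⊕ v)  ≡⟨ cong (u ⊕_) (⊕-self v) ⟩
  u ⊕ 𝟎        ≡⟨ ⊕-identityʳ u ⟩
  u            ∎

⊕≡𝟎⇒≡ : {u v : 𝔽₂^ D} → u ⊕ v ≡ 𝟎 → u ≡ v
⊕≡𝟎⇒≡ {u = u} {v} eq = begin
  u            ≡⟨ ⊕-cancelʳ u v ⟨
  (u ⊕ v) ⊕ v  ≡⟨ cong (_⊕ v) eq ⟩
  𝟎 ⊕ v        ≡⟨ ⊕-identityˡ v ⟩
  v            ∎

true· : (u : 𝔽₂^ D) → true · u ≡ u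
true· = map-id

false· : (u : 𝔽₂^ D) → false · u ≡ 𝟎
false· u = map-const u false

·-distribʳ-⊕ : ∀ a b (u : 𝔽₂^ D) → (a xor b) · u ≡ a · u ⊕ b · u
·-distribʳ-⊕ true true u =
  trans (false· u) (sym (⊕-self (true · u)))
·-distribʳ-⊕ true false u = begin
  true · u             ≡⟨ ⊕-identityʳ _ ⟨
  true · u ⊕ 𝟎         ≡⟨ cong (true · u ⊕_) (false· u) ⟨
  true · u ⊕ false · u ∎
·-distribʳ-⊕ false b u = begin
  b · u             ≡⟨ ⊕-identityˡ _ ⟨
  𝟎 ⊕ b · u         ≡⟨ cong (_⊕ b · u) (false· u) ⟨
  false · u ⊕ b · u ∎

combination-𝟎 : (A : Matrix m D) → combination 𝟎 A ≡ 𝟎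
combination-𝟎 []      = refl
combination-𝟎 (r ∷ A) = begin
  false · r ⊕ combination 𝟎 A  ≡⟨ cong₂ _⊕_ (false· r) (combination-𝟎 A) ⟩
  𝟎 ⊕ 𝟎                        ≡⟨ ⊕-identityˡ 𝟎 ⟩
  𝟎                            ∎

combination-⊕ : ∀ a b (A : Matrix m D) →
  combination (a ⊕ b) A ≡ combination a A ⊕ combination b A
combination-⊕ []      []      []      = sym (⊕-identityˡ 𝟎)
combination-⊕ (x ∷ a) (y ∷ b) (r ∷ A) = begin
  (x xor y) · r ⊕ combination (a ⊕ b) A
    ≡⟨ cong₂ _⊕_ (·-distribʳ-⊕ x y r) (combination-⊕ a b A) ⟩
  (x · r ⊕ y · r) ⊕ (combination a A ⊕ combination b A)
    ≡⟨ ⊕-interchange _ _ _ _ ⟩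
  (x · r ⊕ combination a A) ⊕ (y · r ⊕ combination b A) ∎

combination-e : ∀ i (A : Matrix m D) → combination (e i) A ≡ lookup A i
combination-e zero (r ∷ A) = begin
  true · r ⊕ combination 𝟎 A  ≡⟨ cong₂ _⊕_ (true· r) (combination-𝟎 A) ⟩
  r ⊕ 𝟎                       ≡⟨ ⊕-identityʳ r ⟩
  r                           ∎
combination-e (suc i) (r ∷ A) = begin
  false · r ⊕ combination (e i) A  ≡⟨ cong₂ _⊕_ (false· r) (combination-e i A) ⟩
  𝟎 ⊕ lookup A i                   ≡⟨ ⊕-identityˡ _ ⟩
  lookup A i                       ∎

combination-++ : ∀ (a : Vec Bool m) (b : Vec Bool n) (A : Matrix m D) B →
  combination (a ++ b) (A ++ B) ≡ combination a A ⊕ combination b B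
combination-++ []      b []      B = sym (⊕-identityˡ _)
combination-++ (x ∷ a) b (r ∷ A) B =
  trans (cong (x · r ⊕_) (combination-++ a b A B)) (sym (⊕-assoc _ _ _))

-- Spans, sums of subspaces and linear maps.

Span-least : ∀ {S} (W : Subspace D) → S ⊆ ⟦ W ⟧ → Span S ⊆ ⟦ W ⟧
Span-least W S⊆W (gen v∈S)   = S⊆W v∈S
Span-least W S⊆W zero        = Subspace.𝟎-closed W
Span-least W S⊆W (add u∈ v∈) = Subspace.⊕-closed W (Span-least W S⊆W u∈) (Span-least W S⊆W v∈)

⟨_⟩ : Pred (𝔽₂^ D) 0ℓ → Subspace D
⟨ S ⟩ = record { ⟦_⟧ = Span S ; 𝟎-closed = zero ; ⊕-closed = add }

Span-mono : ∀ {S T : Pred (𝔽₂^ D) 0ℓ} → S ⊆ T → Span S ⊆ Span T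
Span-mono S⊆T = Span-least ⟨ _ ⟩ (λ v∈S → gen (S⊆T v∈S))

rowSpace : Matrix m D → Subspace D
rowSpace A = record
  { ⟦_⟧      = rowspan A
  ; 𝟎-closed = 𝟎 , combination-𝟎 A
  ; ⊕-closed = λ { (a , refl) (b , refl) → a ⊕ b , combination-⊕ a b A }
  }

combination∈ : ∀ (W : Subspace D) (A : Matrix m D) → (∀ i → lookup A i ∈ ⟦ W ⟧) →
  ∀ c → combination c A ∈ ⟦ W ⟧
combination∈ W []      A∈ []          = Subspace.𝟎-closed W
combination∈ W (r ∷ A) A∈ (true  ∷ c) =
  Subspace.⊕-closed W (subst ⟦ W ⟧ (sym (true· r)) (A∈ zero)) (combination∈ W A (A∈ ∘ suc) c)
combination∈ W (r ∷ A) A∈ (false ∷ c) =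
  Subspace.⊕-closed W (subst ⟦ W ⟧ (sym (false· r)) (Subspace.𝟎-closed W))
    (combination∈ W A (A∈ ∘ suc) c)

rowspan⊆ : ∀ (W : Subspace D) (A : Matrix m D) → (∀ i → lookup A i ∈ ⟦ W ⟧) → rowspan A ⊆ ⟦ W ⟧
rowspan⊆ W A A∈ (c , refl) = combination∈ W A A∈ c

lookup∈rowspan : ∀ (A : Matrix m D) i → lookup A i ∈ rowspan A
lookup∈rowspan A i = e i , combination-e i A

infixr 6 _∔_

_∔_ : Subspace D → Subspace D → Subspace D
R ∔ V = record
  { ⟦_⟧      = λ v → ∃[ r ] ∃[ u ] r ∈ ⟦ R ⟧ × u ∈ ⟦ V ⟧ × v ≡ r ⊕ u
  ; 𝟎-closed = 𝟎 , 𝟎 , Subspace.𝟎-closed R , Subspace.𝟎-closed V , sym (⊕-identityˡ 𝟎)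
  ; ⊕-closed = λ { (r , u , r∈ , u∈ , refl) (r′ , u′ , r′∈ , u′∈ , refl) →
      r ⊕ r′ , u ⊕ u′ , Subspace.⊕-closed R r∈ r′∈ , Subspace.⊕-closed V u∈ u′∈ ,
      ⊕-interchange r u r′ u′ }
  }

∔-inˡ : ∀ (R V : Subspace D) → ⟦ R ⟧ ⊆ ⟦ R ∔ V ⟧
∔-inˡ R V {r} r∈R = r , 𝟎 , r∈R , Subspace.𝟎-closed V , sym (⊕-identityʳ r)

∔-inʳ : ∀ (R V : Subspace D) → ⟦ V ⟧ ⊆ ⟦ R ∔ V ⟧
∔-inʳ R V {u} u∈V = 𝟎 , u , Subspace.𝟎-closed R , u∈V , sym (⊕-identityˡ u)

record Linear (f : 𝔽₂^ D → 𝔽₂^ E) : Set where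
  field
    𝟎-homo : f 𝟎 ≡ 𝟎
    ⊕-homo : ∀ u v → f (u ⊕ v) ≡ f u ⊕ f v

open Linear

preimage : {f : 𝔽₂^ D → 𝔽₂^ E} → Linear f → Subspace E → Subspace D
preimage {f = f} L W = record
  { ⟦_⟧      = λ v → f v ∈ ⟦ W ⟧
  ; 𝟎-closed = subst ⟦ W ⟧ (sym (𝟎-homo L)) (Subspace.𝟎-closed W)
  ; ⊕-closed = λ u∈ v∈ → subst ⟦ W ⟧ (sym (⊕-homo L _ _)) (Subspace.⊕-closed W u∈ v∈)
  }

𝟘 : Subspace D
𝟘 = record { ⟦_⟧ = _≡ 𝟎 ; 𝟎-closed = refl ; ⊕-closed = λ { refl refl → ⊕-identityˡ 𝟎 } }

combination-single : ∀ (c : Vec Bool m) t (a : 𝔽₂^ D) →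
  combination c (replicate m 𝟎 [ t ]≔ a) ≡ lookup c t · a
combination-single (x ∷ c) zero a =
  trans (cong (x · a ⊕_) (combination∈ 𝟘 (replicate _ 𝟎) (λ i → lookup-replicate i 𝟎) c))
        (⊕-identityʳ _)
combination-single (x ∷ c) (suc t) a =
  trans (cong₂ _⊕_ (trans (map-replicate (x ∧_) false _) (cong (replicate _) (∧-zeroʳ x)))
                   (combination-single c t a))
        (⊕-identityˡ _)

-- The linear map that sends each `e i` to `f i`.
extend : (Fin m → 𝔽₂^ D) → 𝔽₂^ m → 𝔽₂^ D
extend f c = combination c (tabulate f)

extend-linear : (f : Fin m → 𝔽₂^ D) → Linear (extend f)
extend-linear f = record
  { 𝟎-homo = combination-𝟎 (tabulate f)
  ; ⊕-homo = λ u v → combination-⊕ u v (tabulate f)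
  }

extend-e : ∀ (f : Fin m → 𝔽₂^ D) i → extend f (e i) ≡ f i
extend-e f i = trans (combination-e i (tabulate f)) (lookup∘tabulate f i)

-- Enumeration of bit vectors, for counting by injections.

bits : ∀ n → Fin (2 ^ n) → Vec Bool n
bits n x = tabulate (Inverse.to 2↔Bool ∘ finToFun x)

unbits : Vec Bool n → Fin (2 ^ n)
unbits v = funToFin (Inverse.from 2↔Bool ∘ lookup v)

bits∘unbits : (v : Vec Bool n) → bits n (unbits v) ≡ v
bits∘unbits v = begin
  tabulate (Inverse.to 2↔Bool ∘ finToFun (unbits v))
    ≡⟨ tabulate-cong (λ i → trans (cong (Inverse.to 2↔Bool) (finToFun-funToFin _ i))
                                  (Inverse.strictlyInverseˡ 2↔Bool (lookup v i))) ⟩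
  tabulate (lookup v)
    ≡⟨ tabulate∘lookup v ⟩
  v ∎

funToFin-cong : {f g : Fin m → Fin n} → f ≗ g → funToFin f ≡ funToFin g
funToFin-cong {zero}  f≗g = refl
funToFin-cong {suc m} f≗g = cong₂ combine (f≗g zero) (funToFin-cong (f≗g ∘ suc))

bits-injective : ∀ n {x y : Fin (2 ^ n)} → bits n x ≡ bits n y → x ≡ y
bits-injective n {x} {y} eq = begin
  x                              ≡⟨ funToFin-finToFin {n} x ⟨
  funToFin (finToFun {2} {n} x)  ≡⟨ funToFin-cong (λ i → Injection.injective (↔⇒↣ 2↔Bool) (bit≡ i)) ⟩
  funToFin (finToFun {2} {n} y)  ≡⟨ funToFin-finToFin {n} y ⟩
  y                              ∎
  where
  bit≡ : ∀ i → Inverse.to 2↔Bool (finToFun x i) ≡ Inverse.to 2↔Bool (finToFun y i)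
  bit≡ i = begin
    Inverse.to 2↔Bool (finToFun x i)  ≡⟨ lookup∘tabulate _ i ⟨
    lookup (bits n x) i               ≡⟨ cong (λ v → lookup v i) eq ⟩
    lookup (bits n y) i               ≡⟨ lookup∘tabulate _ i ⟩
    Inverse.to 2↔Bool (finToFun y i)  ∎

-- Linear independence and greedy bases.

LinIndep : Matrix m D → Set
LinIndep A = ∀ c → combination c A ≡ 𝟎 → c ≡ 𝟎

-- Pigeonhole instead of an exchange argument: the `2 ^ m` combinations of independent rows are
-- distinct vectors among the `2 ^ D` available.
LinIndep⇒≤ : (A : Matrix m D) → LinIndep A → m ≤ D
LinIndep⇒≤ {m} {D} A ind = ℕ.≮⇒≥ λ D<m →
  ℕ.<⇒≱ (ℕ.^-monoʳ-< 2 (s≤s (s≤s z≤n)) D<m) (injective⇒≤ {f = f} f-injective)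
  where
  f : Fin (2 ^ m) → Fin (2 ^ D)
  f x = unbits (combination (bits m x) A)
  f-injective : ∀ {x y} → f x ≡ f y → x ≡ y
  f-injective {x} {y} eq = bits-injective m (⊕≡𝟎⇒≡ (ind _ (begin
    combination (bits m x ⊕ bits m y) A
      ≡⟨ combination-⊕ (bits m x) (bits m y) A ⟩
    combination (bits m x) A ⊕ combination (bits m y) A
      ≡⟨ cong (_⊕ combination (bits m y) A)
           (trans (sym (bits∘unbits _)) (trans (cong (bits D) eq) (bits∘unbits _))) ⟩
    combination (bits m y) A ⊕ combination (bits m y) A
      ≡⟨ ⊕-self _ ⟩
    𝟎 ∎)))

-- A greedy pass: `x` is kept if it satisfies `P` and `f x` is not yet spanned. The labels `x` are
-- returned rather than the vectors `f x`, so that an edge keeps its endpoints.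
basis : ∀ {X : Set} (f : X → 𝔽₂^ D) {P : Pred X 0ℓ} → Decidable P → (xs : List X) →
  ∃[ m ] Σ[ b ∈ Vec X m ] (∀ s → lookup b s ∈ P) × LinIndep (map f b) ×
    (∀ {x} → x ∈ₗ xs → x ∈ P → f x ∈ rowspan (map f b))
basis f P? [] = 0 , [] , (λ ()) , (λ { [] _ → refl }) , λ ()
basis f P? (x ∷ xs) with basis f P? xs
... | m , b , b∈P , ind , gens with P? x
...   | no x∉P = m , b , b∈P , ind ,
        λ { (here refl) x∈P → contradiction x∈P x∉P ; (there y∈) y∈P → gens y∈ y∈P }
...   | yes x∈P with rowspan? (map f b) (f x)
...     | yes fx∈ = m , b , b∈P , ind , λ { (here refl) _ → fx∈ ; (there y∈) y∈P → gens y∈ y∈P }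
...     | no fx∉ = suc m , x ∷ b ,
          (λ { zero → x∈P ; (suc s) → b∈P s }) ,
          -- A vanishing combination that uses the new vector would express it through the vectors
          -- already kept.
          (λ { (true ∷ c) eq → contradiction
                 (c , sym (trans (sym (true· (f x))) (⊕≡𝟎⇒≡ eq))) fx∉
             ; (false ∷ c) eq → cong (false ∷_) (ind c (trans (tail-eq c) eq)) }) ,
          λ { (here refl) _ → lookup∈rowspan (map f (x ∷ b)) zero
            ; (there y∈) y∈P → let c , eq = gens y∈ y∈P in
                false ∷ c , trans (sym (tail-eq c)) eq }
          where
          tail-eq : ∀ c → combination c (map f b) ≡ combination (false ∷ c) (map f (x ∷ b))
          tail-eq c = sym (trans (cong (_⊕ _) (false· (f x))) (⊕-identityˡ _))

𝟎++𝟎 : ∀ m {n} → 𝟎 {m} ++ 𝟎 {n} ≡ 𝟎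
𝟎++𝟎 zero    = refl
𝟎++𝟎 (suc m) = cong (false ∷_) (𝟎++𝟎 m)

concatRows : ∀ {n} {ms : Fin n → ℕ} → (∀ t → Matrix (ms t) D) → Matrix (sum (tabulate ms)) D
concatRows {n = zero}  A = []
concatRows {n = suc n} A = A zero ++ concatRows (A ∘ suc)

concatRows⊆ : ∀ {n} {ms : Fin n → ℕ} (A : ∀ t → Matrix (ms t) D) (W : Subspace D) →
  (∀ t → rowspan (A t) ⊆ ⟦ W ⟧) → rowspan (concatRows A) ⊆ ⟦ W ⟧
concatRows⊆ {n = zero}  A W A⊆W ([] , refl) = Subspace.𝟎-closed W
concatRows⊆ {n = suc n} {ms} A W A⊆W (c , refl) with Vec.splitAt (ms zero) c
... | a , b , refl = subst ⟦ W ⟧ (sym (combination-++ a b (A zero) _))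
  (Subspace.⊕-closed W (A⊆W zero (a , refl)) (concatRows⊆ (A ∘ suc) W (A⊆W ∘ suc) (b , refl)))

-- In a vanishing combination the contribution of the first matrix equals that of the remaining
-- ones. It therefore lies in both spans and is zero, and the induction continues with the rest.
concatRows-linIndep : ∀ {n} {ms : Fin n → ℕ} (A : ∀ t → Matrix (ms t) D) → (∀ t → LinIndep (A t)) →
  (∀ t {w} → w ∈ rowspan (A t) → w ∈ Span (λ v → ∃[ s ] s ≢ t × v ∈ rowspan (A s)) → w ≡ 𝟎) →
  LinIndep (concatRows A)
concatRows-linIndep {n = zero}  A ind disj [] _ = refl
concatRows-linIndep {n = suc n} {ms} A ind disj c eq with Vec.splitAt (ms zero) c
... | a , b , refl = begin
  a ++ b  ≡⟨ cong₂ (λ u v → u ++ v) (ind zero a front≡𝟎) (ind′ b back≡𝟎) ⟩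
  𝟎 {ms zero} ++ 𝟎  ≡⟨ 𝟎++𝟎 (ms zero) ⟩
  𝟎       ∎
  where
  A′ = concatRows (A ∘ suc)
  front≡back : combination a (A zero) ≡ combination b A′
  front≡back = ⊕≡𝟎⇒≡ (trans (sym (combination-++ a b (A zero) A′)) eq)
  front≡𝟎 : combination a (A zero) ≡ 𝟎
  front≡𝟎 = disj zero (a , refl) (subst (_∈ Span _) (sym front≡back)
    (concatRows⊆ (A ∘ suc) ⟨ _ ⟩ (λ t w∈ → gen (suc t , (λ ()) , w∈)) (b , refl)))
  back≡𝟎 : combination b A′ ≡ 𝟎
  back≡𝟎 = trans (sym front≡back) front≡𝟎
  ind′ : LinIndep A′
  -- Dropping the first matrix only shrinks the span of the others, so the disjointness hypothesis
  -- passes to the tail.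
  ind′ = concatRows-linIndep (A ∘ suc) (ind ∘ suc) λ t w∈ w∈′ →
    disj (suc t) w∈ (Span-mono (λ { (s , s≢t , v∈) → suc s , (λ { refl → s≢t refl }) , v∈ }) w∈′)

-- Collects finitely many instances of excluded middle under a single double negation.
¬¬-sequence : {P : Pred (Fin n) 0ℓ} → (∀ i → ¬ ¬ P i) → ¬ ¬ (∀ i → P i)
¬¬-sequence = sequence (RawMonad.rawApplicative ¬¬-Monad)

-- Components of edge spaces: colouring and contraction.

⊕-telescope : (a b c : 𝔽₂^ D) → (a ⊕ c) ⊕ (b ⊕ c) ≡ a ⊕ b
⊕-telescope a b c = begin
  (a ⊕ c) ⊕ (b ⊕ c)  ≡⟨ ⊕-interchange a c b c ⟩
  (a ⊕ b) ⊕ (c ⊕ c)  ≡⟨ cong ((a ⊕ b) ⊕_) (⊕-self c) ⟩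
  (a ⊕ b) ⊕ 𝟎        ≡⟨ ⊕-identityʳ _ ⟩
  a ⊕ b              ∎

-- The last element of `Fin (suc n)` signals that nothing satisfies `P`; it becomes the extra colour
-- of `colouring`.
first : {P : Pred (Fin n) 0ℓ} → Decidable P → Fin (suc n)
first {zero}  P? = zero
first {suc n} P? with P? zero
... | yes _ = zero
... | no  _ = suc (first (P? ∘ suc))

first-cong : {P Q : Pred (Fin n) 0ℓ} (P? : Decidable P) (Q? : Decidable Q) →
  P ⊆ Q → Q ⊆ P → first P? ≡ first Q?
first-cong {zero}  P? Q? P⊆Q Q⊆P = refl
first-cong {suc n} P? Q? P⊆Q Q⊆P with P? zero | Q? zero
... | yes _ | yes _ = refl
... | yes p | no ¬q = contradiction (P⊆Q p) ¬q
... | no ¬p | yes q = contradiction (Q⊆P q) ¬p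
... | no _  | no _  = cong suc (first-cong (P? ∘ suc) (Q? ∘ suc) P⊆Q Q⊆P)

first-satisfies : {P : Pred (Fin n) 0ℓ} (P? : Decidable P) {s : Fin n} → P s →
  ∃[ s′ ] first P? ≡ inject₁ s′ × P s′
first-satisfies {suc n} P? {s} Ps with P? zero
... | yes p = zero , refl , p
first-satisfies {suc n} P? {zero}  Ps | no ¬p = contradiction Ps ¬p
first-satisfies {suc n} P? {suc s} Ps | no ¬p =
  let s′ , eq , Ps′ = first-satisfies (P? ∘ suc) Ps in suc s′ , cong suc eq , Ps′

-- The component of a vertex is coloured by the first marked vertex p s in it; the extra colour is
-- shared by the components without marked vertex.
colouring : (Z : Subspace D) (p : Fin n → Fin D) → (∀ i s → Dec (e i ⊕ e (p s) ∈ ⟦ Z ⟧)) →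
  Σ[ γ ∈ (Fin D → Fin (suc n)) ]
    (∀ i j → e i ⊕ e j ∈ ⟦ Z ⟧ → γ i ≡ γ j) ×
    (∀ s s′ → γ (p s) ≡ γ (p s′) → e (p s) ⊕ e (p s′) ∈ ⟦ Z ⟧)
colouring {D} {n} Z p Z? = γ , γ-cong , γ-refl
  where
  joined : ∀ {i j} k → e i ⊕ e k ∈ ⟦ Z ⟧ → e j ⊕ e k ∈ ⟦ Z ⟧ → e i ⊕ e j ∈ ⟦ Z ⟧
  joined k i~k j~k = subst ⟦ Z ⟧ (⊕-telescope _ _ (e k)) (Subspace.⊕-closed Z i~k j~k)

  loop : ∀ s → e (p s) ⊕ e (p s) ∈ ⟦ Z ⟧
  loop s = subst ⟦ Z ⟧ (sym (⊕-self (e (p s)))) (Subspace.𝟎-closed Z)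

  flip : ∀ {i j} → e i ⊕ e j ∈ ⟦ Z ⟧ → e j ⊕ e i ∈ ⟦ Z ⟧
  flip = subst ⟦ Z ⟧ (⊕-comm _ _)

  γ : Fin D → Fin (suc n)
  γ i = first (Z? i)

  γ-cong : ∀ i j → e i ⊕ e j ∈ ⟦ Z ⟧ → γ i ≡ γ j
  γ-cong i j i~j = first-cong (Z? i) (Z? j)
    (λ i~s → joined i (flip i~j) (flip i~s))
    (λ j~s → joined j i~j (flip j~s))

  γ-refl : ∀ s s′ → γ (p s) ≡ γ (p s′) → e (p s) ⊕ e (p s′) ∈ ⟦ Z ⟧
  γ-refl s s′ eq
    with a  , γs≡a   , s~a   ← first-satisfies (Z? (p s))  (loop s)
    with a′ , γs′≡a′ , s′~a′ ← first-satisfies (Z? (p s′)) (loop s′)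
    with refl ← inject₁-injective (trans (sym γs≡a) (trans eq γs′≡a′))
    = joined (p a) s~a s′~a′

-- `Z` is spanned by the edges of a graph on the `D` coordinates, hence determined by the connected
-- components of that graph. Only one inclusion is stated, since the other holds for every subspace.
Graphic : Subspace D → Set
Graphic Z = ⟦ Z ⟧ ⊆ Span (Differences ∩ ⟦ Z ⟧)

EdgesAmong : (Fin n → Fin D) → Pred (𝔽₂^ D) 0ℓ
EdgesAmong p v = ∃[ s ] ∃[ s′ ] v ≡ e (p s) ⊕ e (p s′)

-- Contracting e i to e (γ i) annihilates Z, and on the span of marked edges it is undone modulo Z′ by
-- choosing a marked vertex of each colour.
∩-determined : (p : Fin n → Fin D) (Z Z′ : Subspace D) (γ γ′ : Fin D → Fin m) → Graphic Z →
  (∀ i j → e i ⊕ e j ∈ ⟦ Z ⟧ → γ i ≡ γ j) →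
  (∀ s s′ → γ′ (p s) ≡ γ′ (p s′) → e (p s) ⊕ e (p s′) ∈ ⟦ Z′ ⟧) →
  (∀ s → γ (p s) ≡ γ′ (p s)) →
  ∀ {w} → w ∈ Span (EdgesAmong p) → w ∈ ⟦ Z ⟧ → w ∈ ⟦ Z′ ⟧
∩-determined {n} {D} {m} p Z Z′ γ γ′ graphic γ-cong γ′-refl agree {w} w∈ w∈Z =
  subst ⟦ Z′ ⟧ (begin
    w ⊕ lift (contract w)  ≡⟨ cong (λ u → w ⊕ lift u) (contract-Z (graphic w∈Z)) ⟩
    w ⊕ lift 𝟎             ≡⟨ cong (w ⊕_) (𝟎-homo (extend-linear pick)) ⟩
    w ⊕ 𝟎                  ≡⟨ ⊕-identityʳ w ⟩
    w                      ∎)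
  (Span-least (preimage undo-linear Z′) undo-edge w∈)
  where
  pick : Fin m → 𝔽₂^ D
  pick x with any? (λ s → γ′ (p s) ≟ᶠ x)
  ... | yes (s , _) = e (p s)
  -- An arbitrary value: `pick-joined` meets only colours of marked vertices.
  ... | no _        = 𝟎

  contract : 𝔽₂^ D → 𝔽₂^ m
  contract = extend (e ∘ γ)

  lift : 𝔽₂^ m → 𝔽₂^ D
  lift = extend pick

  contract-edge : ∀ i j → contract (e i ⊕ e j) ≡ e (γ i) ⊕ e (γ j)
  contract-edge i j = trans (⊕-homo (extend-linear (e ∘ γ)) (e i) (e j))
    (cong₂ _⊕_ (extend-e (e ∘ γ) i) (extend-e (e ∘ γ) j))

  contract-Z : Span (Differences ∩ ⟦ Z ⟧) ⊆ λ v → contract v ≡ 𝟎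
  contract-Z = Span-least (preimage (extend-linear (e ∘ γ)) 𝟘)
    λ { ((i , j , _ , refl) , v∈Z) → begin
      contract (e i ⊕ e j)   ≡⟨ contract-edge i j ⟩
      e (γ i) ⊕ e (γ j)      ≡⟨ cong (λ x → e x ⊕ e (γ j)) (γ-cong i j v∈Z) ⟩
      e (γ j) ⊕ e (γ j)      ≡⟨ ⊕-self _ ⟩
      𝟎                      ∎ }

  undo-linear : Linear (λ v → v ⊕ lift (contract v))
  undo-linear = record
    { 𝟎-homo = begin
        𝟎 ⊕ lift (contract 𝟎)  ≡⟨ ⊕-identityˡ _ ⟩
        lift (contract 𝟎)      ≡⟨ cong lift (𝟎-homo (extend-linear (e ∘ γ))) ⟩
        lift 𝟎                 ≡⟨ 𝟎-homo (extend-linear pick) ⟩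
        𝟎                      ∎
    ; ⊕-homo = λ u v → begin
        (u ⊕ v) ⊕ lift (contract (u ⊕ v))
          ≡⟨ cong (λ x → (u ⊕ v) ⊕ lift x) (⊕-homo (extend-linear (e ∘ γ)) u v) ⟩
        (u ⊕ v) ⊕ lift (contract u ⊕ contract v)
          ≡⟨ cong ((u ⊕ v) ⊕_) (⊕-homo (extend-linear pick) (contract u) (contract v)) ⟩
        (u ⊕ v) ⊕ (lift (contract u) ⊕ lift (contract v))
          ≡⟨ ⊕-interchange u v _ _ ⟩
        (u ⊕ lift (contract u)) ⊕ (v ⊕ lift (contract v)) ∎
    }

  pick-joined : ∀ s → e (p s) ⊕ pick (γ (p s)) ∈ ⟦ Z′ ⟧
  pick-joined s with any? (λ s′ → γ′ (p s′) ≟ᶠ γ (p s))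
  ... | yes (s′ , eq) = γ′-refl s s′ (sym (trans eq (agree s)))
  ... | no ∄          = contradiction (s , sym (agree s)) ∄

  undo-edge : EdgesAmong p ⊆ λ v → v ⊕ lift (contract v) ∈ ⟦ Z′ ⟧
  undo-edge (s , s′ , refl) = subst ⟦ Z′ ⟧ (begin
    (e (p s) ⊕ pick (γ (p s))) ⊕ (e (p s′) ⊕ pick (γ (p s′)))
      ≡⟨ ⊕-interchange _ _ _ _ ⟩
    (e (p s) ⊕ e (p s′)) ⊕ (pick (γ (p s)) ⊕ pick (γ (p s′)))
      ≡⟨ cong ((e (p s) ⊕ e (p s′)) ⊕_) (cong₂ _⊕_ (extend-e pick _) (extend-e pick _)) ⟨
    (e (p s) ⊕ e (p s′)) ⊕ (lift (e (γ (p s))) ⊕ lift (e (γ (p s′))))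
      ≡⟨ cong ((e (p s) ⊕ e (p s′)) ⊕_) (⊕-homo (extend-linear pick) (e (γ (p s))) (e (γ (p s′)))) ⟨
    (e (p s) ⊕ e (p s′)) ⊕ lift (e (γ (p s)) ⊕ e (γ (p s′)))
      ≡⟨ cong (λ x → (e (p s) ⊕ e (p s′)) ⊕ lift x) (contract-edge (p s) (p s′)) ⟨
    (e (p s) ⊕ e (p s′)) ⊕ lift (contract (e (p s) ⊕ e (p s′))) ∎)
    (Subspace.⊕-closed Z′ (pick-joined s) (pick-joined s′))

-- Spans of pieces of a decomposition as edge spaces.

spanₛ : Family n D → Pred (Fin n × Bool) 0ℓ → Subspace D
spanₛ U S = record { ⟦_⟧ = spanOver U S ; 𝟎-closed = zero ; ⊕-closed = add }

spanOver-mono : (U : Family n D) {S T : Pred (Fin n × Bool) 0ℓ} → S ⊆ T → spanOver U S ⊆ spanOver U T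
spanOver-mono U S⊆T = Span-mono λ (k , a , ka∈S , v∈) → k , a , S⊆T ka∈S , v∈

spanOver-graphic : (U : Family n D) → (∀ k a → SpannedByDifferences (U k a)) →
  (S : Pred (Fin n × Bool) 0ℓ) → Graphic (spanₛ U S)
spanOver-graphic U diff S = Span-least ⟨ _ ⟩ λ (k , a , ka∈S , v∈) →
  let S′ , S′⊆ , U⊆ , ⊆U = diff k a in
  Span-mono (λ g∈S′ → S′⊆ g∈S′ , gen (k , a , ka∈S , ⊆U (gen g∈S′))) (U⊆ v∈)

∔-graphic : (R V : Subspace D) → Graphic R → Graphic V → Graphic (R ∔ V)
∔-graphic R V gR gV (r , u , r∈R , u∈V , refl) = add
  (Span-mono (λ (δ , ∈R) → δ , ∔-inˡ R V ∈R) (gR r∈R))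
  (Span-mono (λ (δ , ∈V) → δ , ∔-inʳ R V ∈V) (gV u∈V))

-- `SI` with one free row on the left and a block matrix on the right.

toMatrix∘concat : ∀ {d} (A : Matrix d d) → toMatrix d (concat A) ≡ A
toMatrix∘concat {d} A = begin
  tabulate (λ i → tabulate λ j → lookup (concat A) (combine i j))
    ≡⟨ tabulate-cong (λ i → tabulate-cong (lookup-concat A i)) ⟩
  tabulate (λ i → tabulate (lookup (lookup A i)))
    ≡⟨ tabulate-cong (λ i → tabulate∘lookup (lookup A i)) ⟩
  tabulate (lookup A)
    ≡⟨ tabulate∘lookup A ⟩
  A ∎

does-¬? : {P : Set} (P? : Dec P) → does (¬? P?) ≡ true ⇔ (¬ P)
does-¬? (yes p) = mk⇔ (λ ()) (contradiction p)
does-¬? (no ¬p) = mk⇔ (λ _ → ¬p) (λ _ → refl)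

SI-concat : ∀ {d} (A B : Matrix d d) →
  SI d (concat A) (concat B) ≡ true ⇔ (¬ IsZero (rowspan A ∩ rowspan B))
SI-concat {d} A B = subst₂
  (λ A′ B′ → SI d (concat A) (concat B) ≡ true ⇔ (¬ IsZero (rowspan A′ ∩ rowspan B′)))
  (toMatrix∘concat A) (toMatrix∘concat B)
  (does-¬? (isZero? λ v → rowspan? (toMatrix d (concat A)) v ×-dec rowspan? (toMatrix d (concat B)) v))

rowInput : ∀ {d} → Fin d → 𝔽₂^ d → Vec Bool (d * d)
rowInput {d} t a = concat (replicate d 𝟎 [ t ]≔ a)

lookup-rowInput : ∀ {d} (t : Fin d) a k → quotient d k ≢ t → lookup (rowInput t a) k ≡ false
lookup-rowInput {d} t a k k≢t = begin
  lookup (concat A) k                      ≡⟨ cong (lookup (concat A)) (combine-remQuot {d} d k) ⟨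
  lookup (concat A) (combine q r)          ≡⟨ lookup-concat A q r ⟩
  lookup (lookup A q) r                    ≡⟨ cong (λ v → lookup v r) (lookup∘update′ k≢t (replicate d 𝟎) a) ⟩
  lookup (lookup (replicate d 𝟎) q) r      ≡⟨ cong (λ v → lookup v r) (lookup-replicate q 𝟎) ⟩
  lookup 𝟎 r                               ≡⟨ lookup-replicate r false ⟩
  false                                    ∎
  where
  A = replicate d 𝟎 [ t ]≔ a
  q = quotient {d} d k
  r = remainder {d} d k

-- The zero matrix has trivial row space. Through `represents`, this later shows that the fixed
-- pieces of the left side meet `φ V y` trivially.
SI-rowInput-𝟎 : ∀ {d} (t : Fin d) (B : Matrix d d) → SI d (rowInput t 𝟎) (concat B) ≢ true
SI-rowInput-𝟎 {d} t B eq = Equivalence.to (SI-concat _ B) eq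
  ( (λ { ((c , refl) , _) → sym (trans (combination-single c t 𝟎) (c·𝟎 (lookup c t))) })
  , λ { refl → Subspace.𝟎-closed (rowSpace _) , Subspace.𝟎-closed (rowSpace B) } )
  where
  c·𝟎 : ∀ c → c · 𝟎 {d} ≡ 𝟎
  c·𝟎 true  = true· 𝟎
  c·𝟎 false = false· 𝟎

-- The row space on the left consists of `𝟎` and `a` only. The case `a ≡ 𝟎` differs because `𝟎` lies
-- in every row space.
SI-rowInput : ∀ {d} (t : Fin d) a (B : Matrix d d) → a ≢ 𝟎 →
  SI d (rowInput t a) (concat B) ≡ true ⇔ a ∈ rowspan B
SI-rowInput {d} t a B a≢𝟎 = mk⇔
  (λ eq → decidable-stable (rowspan? B a) λ a∉B → Equivalence.to (SI-concat A B) eq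
    ( (λ { ((c , refl) , v∈B) → multiple a∉B (lookup c t)
             (combination-single c t a) v∈B })
    , λ { refl → Subspace.𝟎-closed (rowSpace A) , Subspace.𝟎-closed (rowSpace B) } ))
  (λ a∈B → Equivalence.from (SI-concat A B) λ (⊆𝟎 , _) →
    a≢𝟎 (sym (⊆𝟎 ((e t , trans (combination-e t A) (lookup∘update t (replicate d 𝟎) a)) , a∈B))))
  where
  A = replicate d 𝟎 [ t ]≔ a
  multiple : ¬ (a ∈ rowspan B) → ∀ c {v} → v ≡ c · a → v ∈ rowspan B → 𝟎 ≡ v
  multiple a∉B true  refl v∈B = contradiction (subst (_∈ rowspan B) (true· a) v∈B) a∉B
  multiple a∉B false refl _   = sym (false· a)

-- The block matrix `[ I | M ]`, made square by `k` zero rows. Its row space is the graph of the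
-- linear map that sends `c` to `combination c M`.
graph : ∀ {h k} → Matrix h k → Matrix (h + k) (h + k)
graph {h} {k} M = tabulate λ i → [ (λ j → e j ++ lookup M j) , (λ _ → 𝟎) ]′ (splitAt h i)

row∈graph : ∀ {h k} (M : Matrix h k) i → e i ++ lookup M i ∈ rowspan (graph M)
row∈graph {h} {k} M i = subst (_∈ rowspan (graph M))
  (trans (lookup∘tabulate _ (i ↑ˡ k)) (cong [ _ , _ ]′ (splitAt-↑ˡ h i k)))
  (lookup∈rowspan (graph M) (i ↑ˡ k))

row≢𝟎 : ∀ {h k} (i : Fin h) (v : 𝔽₂^ k) → e i ++ v ≢ 𝟎
row≢𝟎 {h} i v eq with e≡𝟎 ← ++-injectiveˡ (e i) 𝟎 (trans eq (sym (𝟎++𝟎 h)))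
  with () ← trans (sym (lookup∘update i 𝟎 true))
                  (trans (cong (λ u → lookup u i) e≡𝟎) (lookup-replicate i false))

-- Every vector of the row space has the form `c ++ combination c M`, so its left block `e i` forces
-- its right block. Membership queries thus recover the rows of `M`.
row∈graph⇒≡ : ∀ {h k} (M : Matrix h k) i v → e i ++ v ∈ rowspan (graph M) → v ≡ lookup M i
row∈graph⇒≡ {h} {k} M i v row∈ = let c , eq = rowspan⊆ graphSpace (graph M) rows∈ row∈ in
  begin
    v                    ≡⟨ ++-injectiveʳ (e i) c eq ⟩
    combination c M      ≡⟨ cong (λ c → combination c M) (++-injectiveˡ (e i) c eq) ⟨
    combination (e i) M  ≡⟨ combination-e i M ⟩
    lookup M i           ∎
  where
  graphSpace : Subspace (h + k)
  graphSpace = record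
    { ⟦_⟧      = λ u → ∃[ c ] u ≡ c ++ combination c M
    ; 𝟎-closed = 𝟎 , sym (trans (cong (𝟎 ++_) (combination-𝟎 M)) (𝟎++𝟎 h))
    ; ⊕-closed = λ { (c , refl) (c′ , refl) → c ⊕ c′ ,
        trans (zipWith-++ _ c _ c′ _) (cong ((c ⊕ c′) ++_) (sym (combination-⊕ c c′ M))) }
    }
  rows∈ : ∀ i → lookup (graph M) i ∈ ⟦ graphSpace ⟧
  rows∈ i rewrite lookup∘tabulate (λ i → [ (λ j → e j ++ lookup M j) , (λ _ → 𝟎) ]′ (splitAt h i)) i
    with splitAt h i
  ... | inj₁ j = e j , cong (e j ++_) (sym (combination-e j M))
  ... | inj₂ _ = Subspace.𝟎-closed graphSpace

-- Marked endpoints of edges and enumeration of matrices.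

edge : ∀ {D} → Fin D × Fin D → 𝔽₂^ D
edge (i , j) = e i ⊕ e j

-- First endpoints precede second ones, and repetitions are kept, so the number of marks is `m + m`
-- for any edges.
endpoints : ∀ {D m} → Vec (Fin D × Fin D) m → Fin (m + m) → Fin D
endpoints b = lookup (map proj₁ b ++ map proj₂ b)

edge∈EdgesAmong : ∀ {D m} (b : Vec (Fin D × Fin D) m) s →
  lookup (map edge b) s ∈ EdgesAmong (endpoints b)
edge∈EdgesAmong {m = m} b s = s ↑ˡ m , m ↑ʳ s , (begin
  lookup (map edge b) s   ≡⟨ lookup-map s edge b ⟩
  edge (lookup b s)       ≡⟨ cong₂ (λ i j → e i ⊕ e j) (sym left) (sym right) ⟩
  e (endpoints b (s ↑ˡ m)) ⊕ e (endpoints b (m ↑ʳ s)) ∎)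
  where
  left : endpoints b (s ↑ˡ m) ≡ proj₁ (lookup b s)
  left = trans (lookup-++ˡ (map proj₁ b) (map proj₂ b) s) (lookup-map s proj₁ b)
  right : endpoints b (m ↑ʳ s) ≡ proj₂ (lookup b s)
  right = trans (lookup-++ʳ (map proj₁ b) (map proj₂ b) s) (lookup-map s proj₂ b)

matrix : ∀ {h k} → Fin (2 ^ (h * k)) → Matrix h k
matrix {h} {k} x = tabulate λ i → tabulate λ j → lookup (bits (h * k) x) (combine i j)

matrix-injective : ∀ {h k} {x y : Fin (2 ^ (h * k))} →
  (∀ i → lookup (matrix {h} {k} x) i ≡ lookup (matrix y) i) → x ≡ y
matrix-injective {h} {k} {x} {y} eq = bits-injective (h * k) (begin
  bits (h * k) x                    ≡⟨ tabulate∘lookup _ ⟨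
  tabulate (lookup (bits (h * k) x)) ≡⟨ tabulate-cong entry≡ ⟩
  tabulate (lookup (bits (h * k) y)) ≡⟨ tabulate∘lookup _ ⟩
  bits (h * k) y                    ∎)
  where
  entry : ∀ x i j → lookup (lookup (matrix {h} {k} x) i) j ≡ lookup (bits (h * k) x) (combine i j)
  entry x i j = trans (cong (λ r → lookup r j) (lookup∘tabulate _ i)) (lookup∘tabulate _ j)
  entry≡ : ∀ s → lookup (bits (h * k) x) s ≡ lookup (bits (h * k) y) s
  entry≡ s with i , j , refl ← combine-surjective {h} {k} s =
    trans (sym (entry x i j)) (trans (cong (λ r → lookup r j) (eq i)) (entry y i j))

-- Nečiporuk's argument for a fixed decomposition.

module _ (d : ℕ) {D : ℕ} (decomposition : bitpdim (SI d) ≤ D) where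
  open BitwiseDecomposition decomposition

  -- In the row-major encoding `quotient` gives the row of bit `k`. Both values of each bit are
  -- included, so `W t` does not depend on the input.
  Row : Fin d → Pred (Fin (d * d) × Bool) 0ℓ
  Row t (k , _) = quotient {d} d k ≡ t

  OffRow : Fin d → Pred (Fin (d * d) × Bool) 0ℓ
  OffRow t (k , _) = quotient {d} d k ≢ t

  W : Fin d → Subspace D
  W t = spanₛ U (Row t)

  R : Fin d → Subspace D
  R t = spanₛ U λ (k , a) → quotient {d} d k ≢ t × a ≡ false

  φᵛ : Vec Bool (d * d) → Subspace D
  φᵛ y = spanₛ V λ (j , b) → b ≡ lookup y j

  Z : Fin d → Vec Bool (d * d) → Subspace D
  Z t y = R t ∔ φᵛ y

  Z-graphic : ∀ t y → Graphic (Z t y)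
  Z-graphic t y = ∔-graphic (R t) (φᵛ y)
    (spanOver-graphic U U-differences _) (spanOver-graphic V V-differences _)

  row∩offRow : ∀ t {w} → w ∈ ⟦ W t ⟧ → w ∈ spanOver U (OffRow t) → w ≡ 𝟎
  row∩offRow t w∈ w∈′ =
    sym (proj₁ (U-independent (Row t) (OffRow t) (λ (k≡t , k≢t) → k≢t k≡t)) (w∈ , w∈′))

  R⊆φ : ∀ t a → ⟦ R t ⟧ ⊆ φ U (rowInput t a)
  R⊆φ t a = spanOver-mono U λ { (k≢t , refl) → sym (lookup-rowInput t a _ k≢t) }

  -- A piece of row `t` lies in `W t`; a piece of any other row has its bit at 0 and lies in `R t`.
  -- The component `w` is also kept inside `φ U (rowInput t a)`, where `SI-determined` needs it.
  φ-split : ∀ t a {u} → u ∈ φ U (rowInput t a) →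
    ∃[ w ] ∃[ r ] (w ∈ φ U (rowInput t a) × w ∈ ⟦ W t ⟧) × r ∈ ⟦ R t ⟧ × u ≡ w ⊕ r
  φ-split t a = Span-least (P ∔ R t) λ {v} (k , b , b≡ , v∈) → split v k b b≡ v∈
    where
    P : Subspace D
    P = record
      { ⟦_⟧ = φ U (rowInput t a) ∩ ⟦ W t ⟧
      ; 𝟎-closed = zero , zero
      ; ⊕-closed = λ (u∈φ , u∈W) (v∈φ , v∈W) → add u∈φ v∈φ , add u∈W v∈W
      }
    split : ∀ v k b → b ≡ lookup (rowInput t a) k → v ∈ ⟦ U k b ⟧ → v ∈ ⟦ P ∔ R t ⟧
    split v k b b≡ v∈ with quotient {d} d k ≟ᶠ t
    ... | yes k≡t = ∔-inˡ P (R t) (gen (k , b , b≡ , v∈) , gen (k , b , k≡t , v∈))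
    ... | no  k≢t = ∔-inʳ P (R t)
          (gen (k , b , (k≢t , trans b≡ (lookup-rowInput t a k k≢t)) , v∈))

  -- Suppose the intersection for `y′` is trivial and take `u = w ⊕ r` in the one for `y`. Then
  -- `w = r ⊕ u` lies in `Z t y`, hence in `Z t y′`, say `w = r′ ⊕ u′`. Now `u′ = w ⊕ r′` is in the
  -- trivial intersection, so `w = r′` lies both in row `t` and off it and vanishes. What remains,
  -- `u = r`, lies in `R t` and `φ V y`, so it is zero.
  SI-determined : ∀ t a y y′ → (∀ {w} → w ∈ ⟦ W t ⟧ → w ∈ ⟦ Z t y ⟧ → w ∈ ⟦ Z t y′ ⟧) →
    SI d (rowInput t 𝟎) y ≢ true → SI d (rowInput t a) y ≡ true → SI d (rowInput t a) y′ ≡ true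
  SI-determined t a y y′ Z⊆Z′ SI₀≢true SI≡true =
    Equivalence.from (represents (rowInput t a) y′) λ (∩≡𝟎 , _) →
    Equivalence.to (represents (rowInput t a) y) SI≡true
      ((λ (u∈φ , u∈V) → sym (vanishes ∩≡𝟎 u∈φ u∈V)) , λ { refl → zero , zero })
    where
    -- `R t` is contained in `φ U (rowInput t 𝟎)`, so a nonzero common vector would make `SI` true
    -- with the zero row.
    R∩V≡𝟎 : ∀ {u} → u ∈ ⟦ R t ⟧ → u ∈ ⟦ φᵛ y ⟧ → u ≡ 𝟎
    R∩V≡𝟎 {u} u∈R u∈V = decidable-stable (u ≟ᵥ 𝟎) λ u≢𝟎 →
      SI₀≢true (Equivalence.from (represents (rowInput t 𝟎) y) λ (⊆𝟎 , _) →
        u≢𝟎 (sym (⊆𝟎 (R⊆φ t 𝟎 u∈R , u∈V))))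

    vanishes : φ U (rowInput t a) ∩ φ V y′ ⊆ (𝟎 ≡_) →
      ∀ {u} → u ∈ φ U (rowInput t a) → u ∈ ⟦ φᵛ y ⟧ → u ≡ 𝟎
    vanishes ∩≡𝟎 {u} u∈φ u∈V
      with w , r , (w∈φ , w∈W) , r∈R , u≡w⊕r ← φ-split t a u∈φ
      with r′ , u′ , r′∈R , u′∈V , w≡r′⊕u′ ←
        Z⊆Z′ w∈W (r , u , r∈R , u∈V , sym (trans (cong (r ⊕_) (trans u≡w⊕r (⊕-comm w r)))
          (trans (⊕-comm _ _) (trans (cong (_⊕ r) (⊕-comm r w)) (⊕-cancelʳ w r)))))
      = R∩V≡𝟎 (subst ⟦ R t ⟧ (sym u≡r) r∈R) u∈V
      where
      u′≡w⊕r′ : u′ ≡ w ⊕ r′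
      u′≡w⊕r′ = sym (trans (cong (_⊕ r′) (trans w≡r′⊕u′ (⊕-comm r′ u′))) (⊕-cancelʳ u′ r′))
      u′≡𝟎 : u′ ≡ 𝟎
      u′≡𝟎 = sym (∩≡𝟎 (subst (φ U (rowInput t a)) (sym u′≡w⊕r′) (add w∈φ (R⊆φ t a r′∈R)) , u′∈V))
      w≡r′ : w ≡ r′
      w≡r′ = trans w≡r′⊕u′ (trans (cong (r′ ⊕_) u′≡𝟎) (⊕-identityʳ r′))
      w≡𝟎 : w ≡ 𝟎
      w≡𝟎 = row∩offRow t w∈W
        (subst (spanOver U (OffRow t)) (sym w≡r′) (spanOver-mono U proj₁ r′∈R))
      u≡r : u ≡ r
      u≡r = trans u≡w⊕r (trans (cong (_⊕ r) w≡𝟎) (⊕-identityˡ r))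

  -- A spanning forest of the graph whose edges lie in `W t`; `size` is the dimension of `W t`.
  record EdgeBasis (t : Fin d) : Set where
    field
      size     : ℕ
      edges    : Vec (Fin D × Fin D) size
      indep    : LinIndep (map edge edges)
      sound    : rowspan (map edge edges) ⊆ ⟦ W t ⟧
      complete : ⟦ W t ⟧ ⊆ rowspan (map edge edges)
  open EdgeBasis

  edgeBasis : ∀ t → Decidable (λ x → edge x ∈ ⟦ W t ⟧) → EdgeBasis t
  edgeBasis t W? =
    let m , b , b∈W , ind , gens = basis edge W? (cartesianProduct (allFin D) (allFin D)) in
    record
      { size  = m
      ; edges = b
      ; indep = ind
      ; sound = rowspan⊆ (W t) (map edge b) λ s → subst ⟦ W t ⟧ (sym (lookup-map s edge b)) (b∈W s)
      ; complete = λ w∈ → Span-least (rowSpace (map edge b))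
          (λ { ((i , j , _ , refl) , v∈) → gens (∈-cartesianProduct⁺ (∈-allFin i) (∈-allFin j)) v∈ })
          (spanOver-graphic U U-differences (Row t) w∈)
      }

  -- Independence of the pieces makes each `W t` meet the span of the other rows trivially, so the
  -- bases of all rows together are independent in `𝔽₂^ D`.
  sizes≤ : (B : ∀ t → EdgeBasis t) → sum (tabulate (size ∘ B)) ≤ D
  sizes≤ B = LinIndep⇒≤ (concatRows A) (concatRows-linIndep A (indep ∘ B) λ t w∈ w∈′ →
    row∩offRow t (sound (B t) w∈) (Span-least (spanₛ U (OffRow t))
      (λ (s , s≢t , v∈) → spanOver-mono U (λ { refl → s≢t }) (sound (B s) v∈)) w∈′))
    where
    A : ∀ t → Matrix (size (B t)) D
    A t = map edge (edges (B t))

  -- Each `y x` is coded by the colours of the marked vertices in `Z t (y x)`. Equal codes give the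
  -- inclusion required by `SI-determined`, so a one-sided implication is what `separated` has to
  -- turn into equality.
  subfunctions≤ : ∀ {N} t (B : EdgeBasis t) (y : Fin N → Vec Bool (d * d)) →
    (∀ x → SI d (rowInput t 𝟎) (y x) ≢ true) →
    (∀ {x x′} →
      (∀ a → SI d (rowInput t a) (y x) ≡ true → SI d (rowInput t a) (y x′) ≡ true) → x ≡ x′) →
    -- The inequality is decidable, hence stable, so the memberships that `colouring` consults may
    -- be assumed decided.
    N ≤ suc (size B + size B) ^ (size B + size B)
  subfunctions≤ {N} t B y SI₀≢true separated = decidable-stable (N ℕ.≤? _) (¬¬-map bound
    (¬¬-sequence λ x → ¬¬-sequence λ i → ¬¬-sequence λ s → ¬¬-excluded-middle))
    where
    marks : ℕ
    marks = size B + size B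
    p : Fin marks → Fin D
    p = endpoints (edges B)

    bound : (∀ x i s → Dec (e i ⊕ e (p s) ∈ ⟦ Z t (y x) ⟧)) → N ≤ suc marks ^ marks
    bound Z? = injective⇒≤ {f = code} code-injective
      where
      γ : ∀ x → Fin D → Fin (suc marks)
      γ x = proj₁ (colouring (Z t (y x)) p (Z? x))
      code : Fin N → Fin (suc marks ^ marks)
      code x = funToFin (γ x ∘ p)
      W⊆ : ⟦ W t ⟧ ⊆ Span (EdgesAmong p)
      W⊆ = λ w∈ → rowspan⊆ ⟨ EdgesAmong p ⟩ (map edge (edges B))
        (λ s → gen (edge∈EdgesAmong (edges B) s)) (complete B w∈)
      code-injective : ∀ {x x′} → code x ≡ code x′ → x ≡ x′
      code-injective {x} {x′} eq = separated λ a → SI-determined t a (y x) (y x′)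
        (λ w∈W → ∩-determined p (Z t (y x)) (Z t (y x′)) (γ x) (γ x′) (Z-graphic t (y x))
          (proj₁ (proj₂ (colouring (Z t (y x)) p (Z? x))))
          (proj₂ (proj₂ (colouring (Z t (y x′)) p (Z? x′))))
          (λ s → trans (sym (finToFun-funToFin (γ x ∘ p) s))
                 (trans (cong (λ c → finToFun c s) eq) (finToFun-funToFin (γ x′ ∘ p) s)))
          (W⊆ w∈W))
        (SI₀≢true x)

-- Many subfunctions per row, and the conclusion.

-- The rows `e i ++ lookup M i` are accepted by `graph M`, and `graph M′` accepts them only if `M′`
-- has the same rows as `M`. The size enters through an equation so that matching on `refl` turns
-- `d` into `h + k`.
2^[h*k]≤subfunctions : ∀ h k {d D} → h + k ≡ d → (decomposition : bitpdim (SI d) ≤ D) →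
  ∀ t (B : EdgeBasis d decomposition t) →
  2 ^ (h * k) ≤ suc (EdgeBasis.size B + EdgeBasis.size B) ^ (EdgeBasis.size B + EdgeBasis.size B)
2^[h*k]≤subfunctions h k refl decomposition t B = subfunctions≤ (h + k) decomposition t B
  (λ x → concat (graph (matrix {h} {k} x)))
  (λ x → SI-rowInput-𝟎 t (graph (matrix {h} {k} x)))
  λ {x} {x′} implies → matrix-injective {h} {k} λ i → row∈graph⇒≡ (matrix x′) i _
    (Equivalence.to (SI-rowInput t _ _ (row≢𝟎 i _)) (implies _
      (Equivalence.from (SI-rowInput t _ _ (row≢𝟎 i _)) (row∈graph (matrix x) i))))

theorem1p3 : ∃[ C ] ∃[ d₀ ] ∀ (d : ℕ) → d ≥ d₀ → ∀ (D : ℕ) → bitpdim (SI d) ≤ D →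
    d ^ 3 ≤ C * (D * ⌊log₂ d ⌋)
-- The constant 40 comes from `size-bound`; `d ≥ 2` makes the logarithm at least 1. Stability of the
-- inequality again allows membership of edges in each `W t` to be assumed decided.
theorem1p3 = 40 , 2 , λ d d≥2 D decomposition →
  decidable-stable (_ ℕ.≤? _) (¬¬-map (bound d d≥2 D decomposition)
    (¬¬-sequence λ t → ¬¬-sequence λ i → ¬¬-sequence λ j → ¬¬-excluded-middle))
  where
  bound : ∀ d → 2 ≤ d → ∀ D (decomposition : bitpdim (SI d) ≤ D) →
    (∀ t i j → Dec (edge (i , j) ∈ ⟦ W d decomposition t ⟧)) → d ^ 3 ≤ 40 * (D * ⌊log₂ d ⌋)
  bound d 2≤d D decomposition W? = cube-bound ⌊log₂ d ⌋ (EdgeBasis.size ∘ B)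
    (λ t → size-bound d (EdgeBasis.size (B t)) 2≤d
      (2^[h*k]≤subfunctions ⌊ d /2⌋ ⌈ d /2⌉ (ℕ.⌊n/2⌋+⌈n/2⌉≡n d) decomposition t (B t)))
    (sizes≤ d decomposition B)
    where
    B : ∀ t → EdgeBasis d decomposition t
    B t = edgeBasis d decomposition t λ (i , j) → W? t i j
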